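{- For all integers $k\ge 1$ and $\ell,m\ge 0$, there are only finitely many (up to isomorphism) $k$-vertex-critical graphs that are simultaneously $(P_4+\ell P_1)$-free, $B_{4,m}$-free and $B_{3,m}^{+}$-free.
   Context: All graphs are finite and simple. A graph $G$ is $k$-vertex-critical if $\chi(G)=k$ but $\chi(G-v)<k$ for every $v\in V(G)$. A graph is $H$-free if it has no induced subgraph isomorphic to $H$. $P_n$ is the path on $n$ vertices, $P_1$ a single vertex, and $G_1+G_2$ denotes the disjoint union; $P_4+\ell P_1$ is the disjoint union of $P_4$ and $\ell$ isolated vertices. $B_{4,m}$ is the graph obtained from the path $u_1u_2u_3u_4$ by adding $m$ new vertices $w_1,\dots,w_m$ each adjacent only to $u_4$ (i.e. identifying a leaf of $P_4$ with the centre of $K_{1,m}$). $B_{3,m}^{+}$ is the graph with vertices $u_1,u_2,u_3,x,w_1,\dots,w_m$ and edges $u_1u_2$, $u_2u_3$, $u_2x$, $u_3x$ and $u_3w_i$ for $1\le i\le m$ (i.e. the path $u_1u_2u_3$ with $u_3$ identified with the centre of $K_{1,m}$, and a triangle $u_2u_3x$ added on the edge $u_2u_3$). -}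

module Defs where

open import Data.Nat using (ℕ; zero; suc; _+_; _<_; _≤_)
open import Data.Bool using (Bool; true; false; not; _∧_; _∨_)
open import Data.Bool.Properties using (∨-comm)
open import Data.Fin using (Fin; toℕ; punchIn)
open import Data.Fin.Properties using (toℕ-injective)
open import Data.Nat.Properties using (≡ᵇ⇒≡; ≡⇒≡ᵇ)
open import Data.Nat.Base using (_≡ᵇ_)
open import Data.Product using (Σ; _×_; _,_; ∃)
open import Data.List using (List)
open import Data.List.Relation.Unary.Any using (Any)
open import Function.Bundles using (_↔_; Inverse)
open import Relation.Binary.PropositionalEquality using (_≡_; _≢_; refl; sym; cong; cong₂)
open import Relation.Nullary using (¬_)

record Graph : Set where
  field
    n     : ℕ
    adj   : Fin n → Fin n → Bool
    adj-sym    : ∀ u v → adj u v ≡ adj v u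
    adj-irrefl : ∀ v → adj v v ≡ false
open Graph public

Colorable : Graph → ℕ → Set
Colorable G k = Σ (Fin (n G) → Fin k) λ c →
  ∀ u v → adj G u v ≡ true → c u ≢ c v

HasChromaticNumber : Graph → ℕ → Set
HasChromaticNumber G k = Colorable G k × (∀ j → Colorable G j → k ≤ j)

ChromaticLess : Graph → ℕ → Set
ChromaticLess G k = Σ ℕ λ j → j < k × Colorable G j

deleteVertex : (G : Graph) {m : ℕ} → n G ≡ suc m → Fin (n G) → Graph
deleteVertex G {m} refl v = record
  { n = m
  ; adj = λ a b → adj G (punchIn v a) (punchIn v b)
  ; adj-sym = λ a b → adj-sym G (punchIn v a) (punchIn v b)
  ; adj-irrefl = λ a → adj-irrefl G (punchIn v a)
  }

pred-n : (G : Graph) → Fin (n G) → Σ ℕ λ m → n G ≡ suc m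
pred-n G v with n G
... | suc m = m , refl

_-ᵥ_ : (G : Graph) → Fin (n G) → Graph
G -ᵥ v with pred-n G v
... | m , eq = deleteVertex G eq v

VertexCritical : ℕ → Graph → Set
VertexCritical k G = HasChromaticNumber G k × (∀ v → ChromaticLess (G -ᵥ v) k)

InducedSub : Graph → Graph → Set
InducedSub H G = Σ (Fin (n H) → Fin (n G)) λ f →
  (∀ a b → f a ≡ f b → a ≡ b) × (∀ a b → adj H a b ≡ adj G (f a) (f b))

Free : Graph → Graph → Set
Free H G = ¬ InducedSub H G

_≅_ : Graph → Graph → Set
G ≅ H = Σ (Fin (n G) ↔ Fin (n H)) λ φ →
  ∀ a b → adj G a b ≡ adj H (Inverse.to φ a) (Inverse.to φ b)

symAdj : (ℕ → ℕ → Bool) → ℕ → ℕ → Bool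
symAdj r i j = not (i ≡ᵇ j) ∧ (r i j ∨ r j i)

private
  ≡ᵇ-sym : ∀ i j → (i ≡ᵇ j) ≡ (j ≡ᵇ i)
  ≡ᵇ-sym zero zero = refl
  ≡ᵇ-sym zero (suc j) = refl
  ≡ᵇ-sym (suc i) zero = refl
  ≡ᵇ-sym (suc i) (suc j) = ≡ᵇ-sym i j

  ≡ᵇ-refl : ∀ i → (i ≡ᵇ i) ≡ true
  ≡ᵇ-refl zero = refl
  ≡ᵇ-refl (suc i) = ≡ᵇ-refl i

mkGraph : ℕ → (ℕ → ℕ → Bool) → Graph
mkGraph N r = record
  { n = N
  ; adj = λ a b → symAdj r (toℕ a) (toℕ b)
  ; adj-sym = λ a b → cong₂ _∧_ (cong not (≡ᵇ-sym (toℕ a) (toℕ b)))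
                                 (∨-comm (r (toℕ a) (toℕ b)) (r (toℕ b) (toℕ a)))
  ; adj-irrefl = λ a → cong (λ x → not x ∧ (r (toℕ a) (toℕ a) ∨ r (toℕ a) (toℕ a))) (≡ᵇ-refl (toℕ a))
  }

rP4 : ℕ → ℕ → Bool
rP4 0 1 = true
rP4 1 2 = true
rP4 2 3 = true
rP4 _ _ = false

P4+P1s : ℕ → Graph
P4+P1s ℓ = mkGraph (4 + ℓ) rP4

-- B_{4,m}: path u1u2u3u4 = 0,1,2,3; w_i = 4..3+m adjacent to u4 = 3
rB4 : ℕ → ℕ → Bool
rB4 3 (suc (suc (suc (suc _)))) = true
rB4 i j = rP4 i j

B4 : ℕ → Graph
B4 m = mkGraph (4 + m) rB4

-- B⁺_{3,m}: u1=0, u2=1, u3=2, x=3, w_i = 4..3+m;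
-- edges u1u2, u2u3, u2x, u3x, u3w_i
rB3+ : ℕ → ℕ → Bool
rB3+ 0 1 = true
rB3+ 1 2 = true
rB3+ 1 3 = true
rB3+ 2 3 = true
rB3+ 2 (suc (suc (suc (suc _)))) = true
rB3+ _ _ = false

B3+ : ℕ → Graph
B3+ m = mkGraph (4 + m) rB3+

{-# OPTIONS --safe #-}

-- Let t = 1 + ℓ + m.  Start from a large colour class, seen as a family of pairwise anticomplete
-- connected blocks, and repeatedly absorb an outside vertex y that misses at least t blocks, always one
-- touching as few blocks as possible.  As G is (P₄ + ℓP₁)-free, a y touching two or more blocks is complete
-- to them, so absorbing y raises a clique number: merging at most N blocks at a time, there are never
-- fewer than N.  If some y would merge more than N blocks, pass to the family of blocks it touches.
-- Either way every outside vertex touching the family misses fewer than t blocks: in the second case a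
-- vertex z violating this has a neighbour x in an untouched block, and x, z, y, a common neighbour of z
-- and y, and the blocks missed by z give B₄,ₘ or B⁺₃,ₘ, according to whether z ≁ y or z ~ y.
-- (P₄ + ℓP₁)-freeness then makes such outside vertices complete to all but boundedly many blocks.
-- Take a block C₁ of least chromatic number, a (k−1)-colouring of G minus a vertex of C₁, and one
-- representative per colour among the outside neighbours of C₁.  Some block C is complete to all
-- representatives, so its colours can be reused on C₁: a (k−1)-colouring of G.  Hence |G| is bounded.
module Submission where

open import Defs
open import Data.Bool using (Bool; true; false; not; _∧_; _∨_)
import Data.Bool.Properties as Bool
open import Data.Empty using (⊥; ⊥-elim)
open import Data.Fin using (Fin; zero; suc; toℕ; punchOut; inject≤)
open import Data.Fin.Patterns using (0F; 1F; 2F; 3F)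
open import Data.Fin.Properties using (_≟_; any?; injective⇒≤; punchIn-punchOut; inject≤-injective; <-cmp)
open import Data.List using (List; []; _∷_; map; filter; length; concatMap; allFin; lookup; upTo; deduplicate; cartesianProductWith)
open import Data.List.Extrema.Nat using (argmin; argmax; argmin-all; argmin-sel; argmax-sel; f[argmin]≤f[xs]; f[argmin]≤f[⊤]; f[xs]≤f[argmax]; f[⊥]≤f[argmax])
open import Data.List.Membership.Propositional using (_∈_; _∉_; find; lose)
open import Data.List.Membership.Propositional.Properties
  using (∈-filter⁺; ∈-filter⁻; ∈-concatMap⁺; ∈-concatMap⁻; ∈-allFin; ∈-lookup; ∈-length; ∈-cartesianProductWith⁺; ∈-upTo⁺; ∈-deduplicate⁺; ∈-deduplicate⁻; ∈-map⁺; ∈-map⁻)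
import Data.List.Membership.DecPropositional as DecMembership
open import Data.List.Properties using (length-tabulate)
open import Data.List.Relation.Unary.All as All using (All; []; _∷_)
import Data.List.Relation.Unary.All.Properties as All
open import Data.List.Relation.Unary.AllPairs as AllPairs using (AllPairs; []; _∷_)
import Data.List.Relation.Unary.AllPairs.Properties as AllPairs
open import Data.List.Relation.Unary.Any as Any using (Any; here; there)
open import Data.List.Relation.Unary.Any.Properties using (lookup-index)
open import Data.List.Relation.Unary.Unique.Propositional.Properties using (allFin⁺)
open import Data.List.Relation.Unary.Unique.DecPropositional.Properties using (deduplicate-!)
open import Data.Nat using (ℕ; zero; suc; _+_; _*_; _^_; _≤_; _<_; _≥_; z≤n; s≤s; _≤?_; _<?_)
open import Data.Nat.Induction using (Acc; acc; <-wellFounded)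
open import Data.Nat.ListAction using (sum)
open import Data.Nat.Properties hiding (_≟_; <-cmp)
open import Data.Product using (Σ; ∃; ∃₂; _×_; _,_; proj₁; proj₂)
open import Data.Sum using (_⊎_; inj₁; inj₂; [_,_]′)
open import Data.Vec as Vec using (Vec)
import Data.Vec.Properties as Vec
import Data.Vec.Functional as Fun
open import Function using (_∘_; id)
open import Function.Construct.Identity using (↔-id)
open import Relation.Binary using (Symmetric; tri<; tri≈; tri>)
open import Relation.Binary.PropositionalEquality using (_≡_; _≢_; refl; sym; trans; cong; cong₂; subst; _≗_; ≢-sym)
open import Relation.Nullary using (¬_; Dec; yes; no; contradiction)
open import Relation.Nullary.Decidable using (¬?; _×-dec_; _→-dec_; map′; decidable-stable)
open import Relation.Unary using (Decidable)

private variable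
  A B : Set

∉⇒≢ : ∀ {x y : A} {xs} → x ∉ xs → y ∈ xs → x ≢ y
∉⇒≢ x∉ y∈ refl = x∉ y∈

-- Counting in lists

module _ {P Q : A → Set} (P? : Decidable P) (Q? : Decidable Q) where

  count-mono : ∀ xs → (∀ {x} → x ∈ xs → P x → Q x) →
               length (filter P? xs) ≤ length (filter Q? xs)
  count-mono [] _ = z≤n
  count-mono (x ∷ xs) P⇒Q with ih ← count-mono xs (P⇒Q ∘ there) | P? x | Q? x
  ... | yes _ | yes _ = s≤s ih
  ... | yes p | no ¬q = contradiction (P⇒Q (here refl) p) ¬q
  ... | no _  | yes _ = m≤n⇒m≤1+n ih
  ... | no _  | no _  = ih

  count-mono-< : ∀ {y} xs → (∀ {x} → x ∈ xs → P x → Q x) → y ∈ xs → Q y → ¬ P y →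
                 length (filter P? xs) < length (filter Q? xs)
  count-mono-< (x ∷ xs) P⇒Q (here refl) q ¬p with ih ← count-mono xs (P⇒Q ∘ there) | P? x | Q? x
  ... | yes p | _     = contradiction p ¬p
  ... | no _  | yes _ = s≤s ih
  ... | no _  | no ¬q = contradiction q ¬q
  count-mono-< (x ∷ xs) P⇒Q (there y∈) q ¬p with ih ← count-mono-< xs (P⇒Q ∘ there) y∈ q ¬p | P? x | Q? x
  ... | yes _ | yes _ = s≤s ih
  ... | yes p | no ¬q = contradiction (P⇒Q (here refl) p) ¬q
  ... | no _  | yes _ = m≤n⇒m≤1+n ih
  ... | no _  | no _  = ih

  count-filter-≤ : ∀ xs → length (filter P? (filter Q? xs)) ≤ length (filter P? xs)
  count-filter-≤ [] = z≤n
  count-filter-≤ (x ∷ xs) with ih ← count-filter-≤ xs | Q? x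
  count-filter-≤ (x ∷ xs) | yes _ with P? x
  ... | yes _ = s≤s ih
  ... | no _  = ih
  count-filter-≤ (x ∷ xs) | no _ with P? x
  ... | yes _ = m≤n⇒m≤1+n ih
  ... | no _  = ih

  count-filter-≥ : ∀ xs → (∀ {x} → x ∈ xs → P x → Q x) →
                   length (filter P? xs) ≤ length (filter P? (filter Q? xs))
  count-filter-≥ [] _ = z≤n
  count-filter-≥ (x ∷ xs) P⇒Q with ih ← count-filter-≥ xs (P⇒Q ∘ there) | Q? x
  count-filter-≥ (x ∷ xs) P⇒Q | yes _ with P? x
  ... | yes _ = s≤s ih
  ... | no _  = ih
  count-filter-≥ (x ∷ xs) P⇒Q | no ¬q with P? x
  ... | yes p = contradiction (P⇒Q (here refl) p) ¬q
  ... | no _  = ih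

module _ {P : A → Set} (P? : Decidable P) where

  length-split : ∀ xs → length (filter P? xs) + length (filter (¬? ∘ P?) xs) ≡ length xs
  length-split [] = refl
  length-split (x ∷ xs) with ih ← length-split xs | P? x
  ... | yes _ = cong suc ih
  ... | no _  = trans (+-suc _ _) (cong suc ih)

  sum-split : ∀ (w : A → ℕ) xs →
              sum (map w (filter P? xs)) + sum (map w (filter (¬? ∘ P?) xs)) ≡ sum (map w xs)
  sum-split w [] = refl
  sum-split w (x ∷ xs) with ih ← sum-split w xs | P? x
  ... | yes _ = trans (+-assoc (w x) _ _) (cong (w x +_) ih)
  ... | no _  = trans (x+[y+z]≡y+[x+z] (sum (map w (filter P? xs))) (w x) _) (cong (w x +_) ih)
    where
    x+[y+z]≡y+[x+z] : ∀ a b c → a + (b + c) ≡ b + (a + c)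
    x+[y+z]≡y+[x+z] a b c = trans (sym (+-assoc a b c)) (trans (cong (_+ c) (+-comm a b)) (+-assoc b a c))

sum-≤ : ∀ (w : A → ℕ) {c} xs → (∀ {x} → x ∈ xs → w x ≤ c) → sum (map w xs) ≤ length xs * c
sum-≤ w [] _ = z≤n
sum-≤ w (x ∷ xs) w≤c = +-mono-≤ (w≤c (here refl)) (sum-≤ w xs (w≤c ∘ there))

-- Union bound: discarding what is bad for each `b` in turn costs at most `c` elements, so something
-- survives.
avoid : {Bad : B → A → Set} (Bad? : ∀ b → Decidable (Bad b)) {c : ℕ} (bs : List B) (xs : List A) →
        (∀ {b} → b ∈ bs → length (filter (Bad? b) xs) ≤ c) → length bs * c < length xs →
        ∃ λ x → x ∈ xs × All (λ b → ¬ Bad b x) bs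
avoid Bad? [] (x ∷ xs) _ _ = x , here refl , []
avoid Bad? {c} (b ∷ bs) xs few long =
  let x , x∈ys , good = avoid Bad? bs ys
        (λ b∈ → ≤-trans (count-filter-≤ (Bad? _) (¬? ∘ Bad? b) xs) (few (there b∈)))
        (+-cancelˡ-< c _ _ (<-≤-trans long (subst (_≤ c + length ys) (length-split (Bad? b) xs)
          (+-monoˡ-≤ (length ys) (few (here refl))))))
      x∈xs , ok = ∈-filter⁻ (¬? ∘ Bad? b) x∈ys
  in x , x∈xs , ok ∷ good
  where ys = filter (¬? ∘ Bad? b) xs

length-allFin : ∀ n → length (allFin n) ≡ n
length-allFin n = length-tabulate id

crowded-class : ∀ {k} (f : A → Fin k) (c : ℕ) (xs : List A) → k * c < length xs →
                ∃ λ i → c < length (filter (λ x → f x ≟ i) xs)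
crowded-class {k = k} f c xs long with any? (λ i → c <? length (filter (λ x → f x ≟ i) xs))
... | yes found = found
... | no none =
  let x , _ , avoids = avoid (λ i x → f x ≟ i) (allFin k) xs (λ {i} _ → ≮⇒≥ (λ c< → none (i , c<)))
                         (subst (λ n → n * c < length xs) (sym (length-allFin k)) long)
  in ⊥-elim (All.lookup avoids (∈-allFin (f x)) refl)

representatives : ∀ {j} {P : A → Set} (f : A → Fin j) (cs : List (Fin j)) →
                  (∀ i → Dec (∃ λ x → P x × f x ≡ i)) →
                  ∃ λ rs → length rs ≤ length cs × All P rs × (∀ {x} → P x → f x ∈ cs → Any (λ r → f r ≡ f x) rs)
representatives f [] _ = [] , z≤n , [] , λ _ ()
representatives f (c ∷ cs) search with representatives f cs search | search c
... | rs , short , good , rep | yes (r , p , fr≡c) = r ∷ rs , s≤s short , p ∷ good ,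
      λ { _ (here eq) → here (trans fr≡c (sym eq)) ; q (there fx∈) → there (rep q fx∈) }
... | rs , short , good , rep | no none = rs , m≤n⇒m≤1+n short , good ,
      λ { q (here eq) → contradiction (_ , q , eq) none ; q (there fx∈) → rep q fx∈ }

-- Lists of pairwise related elements

module _ {R : A → A → Set} (R-sym : Symmetric R) where

  pairs-∈ : ∀ {xs x y} → AllPairs R xs → x ∈ xs → y ∈ xs → x ≡ y ⊎ R x y
  pairs-∈ _        (here refl) (here refl) = inj₁ refl
  pairs-∈ (r ∷ _)  (here refl) (there y∈)  = inj₂ (All.lookup r y∈)
  pairs-∈ (r ∷ _)  (there x∈)  (here refl) = inj₂ (R-sym (All.lookup r x∈))
  pairs-∈ (_ ∷ rs) (there x∈)  (there y∈)  = pairs-∈ rs x∈ y∈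

  pairs-partner : ∀ {xs x} → AllPairs R xs → 2 ≤ length xs → x ∈ xs → ∃ λ y → y ∈ xs × R x y
  pairs-partner {_ ∷ []} _ (s≤s ()) _
  pairs-partner {_ ∷ _ ∷ _} ((r ∷ _) ∷ _) _ (here refl) = _ , there (here refl) , r
  pairs-partner {_ ∷ _ ∷ _} (r ∷ _)       _ (there x∈)  = _ , here refl , R-sym (All.lookup r x∈)

  pairs-lookup : ∀ {xs} → AllPairs R xs → ∀ i j → i ≢ j → R (lookup xs i) (lookup xs j)
  pairs-lookup (_ ∷ _)  zero    zero    i≢j = contradiction refl i≢j
  pairs-lookup (r ∷ _)  zero    (suc j) _   = All.lookup r (∈-lookup j)
  pairs-lookup (r ∷ _)  (suc i) zero    _   = R-sym (All.lookup r (∈-lookup i))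
  pairs-lookup (_ ∷ rs) (suc i) (suc j) i≢j = pairs-lookup rs i j (i≢j ∘ cong suc)

pairs-with-all : ∀ {R : A → A → Set} {P : A → Set} {xs} → AllPairs R xs → All P xs →
                 AllPairs (λ x y → R x y × P x × P y) xs
pairs-with-all []       []       = []
pairs-with-all (r ∷ rs) (p ∷ ps) = All.zipWith (λ (rxy , py) → rxy , p , py) (r , ps) ∷ pairs-with-all rs ps

-- Finite search

least : {P : ℕ → Set} → Decidable P → ∀ b → P b → ∃ λ s → P s × ∀ {r} → P r → s ≤ r
least P? b pb with P? 0
least P? b       pb | yes p0 = 0 , p0 , λ _ → z≤n
least P? zero    pb | no ¬p0 = contradiction pb ¬p0
least {P} P? (suc b) pb | no ¬p0 =
  let s , ps , min = least (P? ∘ suc) b pb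
  in suc s , ps , λ { {zero} p0 → contradiction p0 ¬p0 ; {suc r} pr → s≤s (min pr) }

minimiser : ∀ {n} {P : Fin n → Set} → Decidable P → (f : Fin n → ℕ) →
            (∀ y → ¬ P y) ⊎ (∃ λ y → P y × ∀ {z} → P z → f y ≤ f z)
minimiser {n} P? f with any? P?
... | no none = inj₁ λ y p → none (y , p)
... | yes (y , p) = inj₂ (argmin f y ps , argmin-all f p (All.all-filter P? (allFin n)) ,
        λ {z} pz → All.lookup (f[argmin]≤f[xs] y ps) (∈-filter⁺ P? (∈-allFin z) pz))
  where ps = filter P? (allFin n)

-- A function agrees only pointwise with the one rebuilt from its values; `resp` transports `P`
-- along this agreement.
∃-function? : ∀ n {s} {P : (Fin n → Fin s) → Set} → (∀ {f g} → f ≗ g → P f → P g) →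
              Decidable P → Dec (∃ P)
∃-function? zero resp P? =
  map′ (λ p → _ , p) (λ (_ , p) → resp (λ ()) p) (P? λ ())
∃-function? (suc n) {P = P} resp P? =
  map′ (λ (x , g , p) → x Fun.∷ g , p)
       (λ (f , p) → f zero , f ∘ suc , resp (λ { zero → refl ; (suc _) → refl }) p)
       (any? λ x → ∃-function? n (λ f≗g → resp λ { zero → refl ; (suc i) → f≗g i }) (λ g → P? (x Fun.∷ g)))

-- Enumeration of graphs

allVecs : List A → ∀ n → List (Vec A n)
allVecs xs zero    = Vec.[] ∷ []
allVecs xs (suc n) = cartesianProductWith Vec._∷_ xs (allVecs xs n)

∈-allVecs : ∀ {xs : List A} → (∀ a → a ∈ xs) → ∀ {n} (v : Vec A n) → v ∈ allVecs xs n
∈-allVecs all Vec.[]      = here refl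
∈-allVecs all (a Vec.∷ v) = ∈-cartesianProductWith⁺ Vec._∷_ (all a) (∈-allVecs all v)

∈-bools : ∀ b → b ∈ true ∷ false ∷ []
∈-bools true  = here refl
∈-bools false = there (here refl)

-- Clearing the diagonal and symmetrising turns every Boolean matrix into a graph, so the
-- enumeration needs no filter.
fromMatrix : ∀ {n} → Vec (Vec Bool n) n → Graph
fromMatrix {n} M = record
  { n          = n
  ; adj        = edge
  ; adj-sym    = λ u v → edge-sym u v (u ≟ v) (v ≟ u)
  ; adj-irrefl = λ v → edge-irrefl v (v ≟ v)
  }
  where
  entry : Fin n → Fin n → Bool
  entry u v = Vec.lookup (Vec.lookup M u) v

  edge′ : ∀ {u v : Fin n} → Dec (u ≡ v) → Bool
  edge′ (yes _) = false
  edge′ {u} {v} (no _) = entry u v ∨ entry v u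

  edge : Fin n → Fin n → Bool
  edge u v = edge′ (u ≟ v)

  edge-sym : ∀ u v (d : Dec (u ≡ v)) (d′ : Dec (v ≡ u)) → edge′ d ≡ edge′ d′
  edge-sym u v (yes _)  (yes _)  = refl
  edge-sym u v (yes eq) (no neq) = contradiction (sym eq) neq
  edge-sym u v (no neq) (yes eq) = contradiction (sym eq) neq
  edge-sym u v (no _)   (no _)   = Bool.∨-comm (entry u v) (entry v u)

  edge-irrefl : ∀ v (d : Dec (v ≡ v)) → edge′ d ≡ false
  edge-irrefl v (yes _)  = refl
  edge-irrefl v (no neq) = contradiction refl neq

matrix : (G : Graph) → Vec (Vec Bool (n G)) (n G)
matrix G = Vec.tabulate λ u → Vec.tabulate (adj G u)

≅-fromMatrix : ∀ G → G ≅ fromMatrix (matrix G)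
≅-fromMatrix G = ↔-id _ , λ u v → same u v
  where
  entry≡ : ∀ u v → Vec.lookup (Vec.lookup (matrix G) u) v ≡ adj G u v
  entry≡ u v = trans (cong (λ row → Vec.lookup row v) (Vec.lookup∘tabulate _ u)) (Vec.lookup∘tabulate _ v)

  same : ∀ u v → adj G u v ≡ adj (fromMatrix (matrix G)) u v
  same u v with u ≟ v
  ... | yes refl = adj-irrefl G u
  ... | no _ = sym (trans (cong₂ _∨_ (entry≡ u v) (trans (entry≡ v u) (adj-sym G v u))) (Bool.∨-idem _))

graphsOfOrder : ℕ → List Graph
graphsOfOrder n = map fromMatrix (allVecs (allVecs (true ∷ false ∷ []) n) n)

graphsUpTo : ℕ → List Graph
graphsUpTo b = concatMap graphsOfOrder (upTo (suc b))

graphsUpTo-complete : ∀ {b} G → n G ≤ b → Any (G ≅_) (graphsUpTo b)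
graphsUpTo-complete G n≤b = lose
  (∈-concatMap⁺ graphsOfOrder (lose (∈-upTo⁺ (s≤s n≤b))
    (∈-map⁺ fromMatrix (∈-allVecs (∈-allVecs ∈-bools) (matrix G)))))
  (≅-fromMatrix G)

-- Adjacency, induced subgraphs and connected blocks

punctured-colouring : ∀ G {k} v {u₀} → ChromaticLess (G -ᵥ v) k → v ≢ u₀ →
  ∃ λ j → j < k × Σ (Fin (n G) → Fin j) λ φ →
    ∀ {u w} → v ≢ u → v ≢ w → adj G u w ≡ true → φ u ≢ φ w
punctured-colouring record { n = suc _ ; adj = adj } v (j , j<k , c , proper) v≢u₀ = j , j<k , φ , φ-proper
  where
  φ : Fin _ → Fin j
  φ u with v ≟ u
  -- `φ` is made total by giving `v` the colour of `u₀`; without a second vertex `Fin j` could be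
  -- empty.
  ... | yes _  = c (punchOut v≢u₀)
  ... | no v≢u = c (punchOut v≢u)

  φ-proper : ∀ {u w} → v ≢ u → v ≢ w → adj u w ≡ true → φ u ≢ φ w
  φ-proper {u} {w} v≢u v≢w uw with v ≟ u | v ≟ w
  ... | yes v≡u | _       = contradiction v≡u v≢u
  ... | no _    | yes v≡w = contradiction v≡w v≢w
  ... | no v≢u′ | no v≢w′ = proper _ _
          (trans (cong₂ adj (punchIn-punchOut v≢u′) (punchIn-punchOut v≢w′)) uw)

module _ {n : ℕ} where
  open DecMembership (_≟_ {n}) public using (_∈?_)

module Blocks (G : Graph) where

  V : Set
  V = Fin (n G)

  infix 4 _~_ _~?_
  _~_ : V → V → Set
  u ~ v = adj G u v ≡ true

  _~?_ : ∀ u v → Dec (u ~ v)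
  u ~? v = adj G u v Bool.≟ true

  ~-sym : Symmetric _~_
  ~-sym {u} {v} uv = trans (adj-sym G v u) uv

  ~⇒≢ : ∀ {u v} → u ~ v → u ≢ v
  ~⇒≢ {u} uv refl = contradiction (trans (sym uv) (adj-irrefl G u)) λ ()

  -- Distinctness is built in so that one table of links yields both injectivity and preservation of
  -- adjacency.
  Link : Bool → V → V → Set
  Link b u v = u ≢ v × adj G u v ≡ b

  Apart : V → V → Set
  Apart = Link false

  Link-sym : ∀ {b} → Symmetric (Link b)
  Link-sym {x = u} {v} (u≢v , uv) = ≢-sym u≢v , trans (adj-sym G v u) uv

  edge : ∀ {u v} → u ~ v → Link true u v
  edge uv = ~⇒≢ uv , uv

  apart : ∀ {u v} → u ≢ v → ¬ u ~ v → Apart u v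
  apart u≢v ¬uv = u≢v , Bool.¬-not ¬uv

  apart⇒¬~ : ∀ {u v} → Apart u v → ¬ u ~ v
  apart⇒¬~ (_ , uv) uv′ = contradiction (trans (sym uv′) uv) λ ()

  induced : ∀ H (f : Fin (n H) → V) → (∀ a b → a ≢ b → Link (adj H a b) (f a) (f b)) → InducedSub H G
  induced H f link = f , injective , preserves
    where
    injective : ∀ a b → f a ≡ f b → a ≡ b
    injective a b fa≡fb with a ≟ b
    ... | yes a≡b = a≡b
    ... | no a≢b  = contradiction fa≡fb (proj₁ (link a b a≢b))

    preserves : ∀ a b → adj H a b ≡ adj G (f a) (f b)
    preserves a b with a ≟ b
    ... | yes refl = trans (adj-irrefl H a) (sym (adj-irrefl G (f a)))
    ... | no a≢b   = sym (proj₂ (link a b a≢b))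

  module _ {m : ℕ} (r : ℕ → ℕ → Bool) {u₀ u₁ u₂ u₃ : V} {w : Fin m → V} where

    -- The three forbidden graphs share this shape: four core vertices followed by a tail `w`. By
    -- symmetry only ascending pairs have to be checked.
    pendant-induced :
      Link (symAdj r 0 1) u₀ u₁ → Link (symAdj r 0 2) u₀ u₂ → Link (symAdj r 0 3) u₀ u₃ →
      Link (symAdj r 1 2) u₁ u₂ → Link (symAdj r 1 3) u₁ u₃ → Link (symAdj r 2 3) u₂ u₃ →
      (∀ i → Link (symAdj r 0 (4 + toℕ i)) u₀ (w i)) → (∀ i → Link (symAdj r 1 (4 + toℕ i)) u₁ (w i)) →
      (∀ i → Link (symAdj r 2 (4 + toℕ i)) u₂ (w i)) → (∀ i → Link (symAdj r 3 (4 + toℕ i)) u₃ (w i)) →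
      (∀ i j → i ≢ j → Link (symAdj r (4 + toℕ i) (4 + toℕ j)) (w i) (w j)) →
      InducedSub (mkGraph (4 + m) r) G
    pendant-induced l₀₁ l₀₂ l₀₃ l₁₂ l₁₃ l₂₃ p₀ p₁ p₂ p₃ q = induced H place link
      where
      H : Graph
      H = mkGraph (4 + m) r

      place : Fin (4 + m) → V
      place = u₀ Fun.∷ u₁ Fun.∷ u₂ Fun.∷ u₃ Fun.∷ w

      ascending : ∀ a b → toℕ a < toℕ b → Link (adj H a b) (place a) (place b)
      ascending 0F 1F _ = l₀₁
      ascending 0F 2F _ = l₀₂
      ascending 0F 3F _ = l₀₃
      ascending 0F (suc (suc (suc (suc i)))) _ = p₀ i
      ascending 1F 1F (s≤s ())
      ascending 1F 2F _ = l₁₂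
      ascending 1F 3F _ = l₁₃
      ascending 1F (suc (suc (suc (suc i)))) _ = p₁ i
      ascending 2F 1F (s≤s ())
      ascending 2F 2F (s≤s (s≤s ()))
      ascending 2F 3F _ = l₂₃
      ascending 2F (suc (suc (suc (suc i)))) _ = p₂ i
      ascending 3F 1F (s≤s ())
      ascending 3F 2F (s≤s (s≤s ()))
      ascending 3F 3F (s≤s (s≤s (s≤s ())))
      ascending 3F (suc (suc (suc (suc i)))) _ = p₃ i
      ascending (suc (suc (suc (suc _)))) 1F (s≤s ())
      ascending (suc (suc (suc (suc _)))) 2F (s≤s (s≤s ()))
      ascending (suc (suc (suc (suc _)))) 3F (s≤s (s≤s (s≤s ())))
      ascending (suc (suc (suc (suc i)))) (suc (suc (suc (suc j)))) lt =
        q i j λ { refl → <-irrefl refl lt }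

      link : ∀ a b → a ≢ b → Link (adj H a b) (place a) (place b)
      link a b a≢b with <-cmp a b
      ... | tri< a<b _ _ = ascending a b a<b
      ... | tri≈ _ a≡b _ = contradiction a≡b a≢b
      ... | tri> _ _ b<a = subst (λ e → Link e (place a) (place b)) (adj-sym H b a)
                             (Link-sym (ascending b a b<a))

  Independent : ∀ {r} → (Fin r → V) → Set
  Independent w = ∀ i j → i ≢ j → Apart (w i) (w j)

  module _ {m : ℕ} {a b c d : V} {w : Fin m → V} (indep : Independent w) where

    private
      -- Between tail vertices the relation inside `symAdj` computes to `false`, while the factor
      -- `not (i ≡ᵇ j)` stays stuck; that factor is `e`.
      non-edge : ∀ {u v} e → Apart u v → Link (e ∧ false) u v
      non-edge e (u≢v , uv) = u≢v , trans uv (sym (Bool.∧-zeroʳ e))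

    induced-P4+P1s : a ~ b → Apart a c → Apart a d → b ~ c → Apart b d → c ~ d →
      (∀ i → Apart a (w i)) → (∀ i → Apart b (w i)) → (∀ i → Apart c (w i)) → (∀ i → Apart d (w i)) →
      InducedSub (P4+P1s m) G
    induced-P4+P1s ab ac ad bc bd cd aw bw cw dw =
      pendant-induced rP4 (edge ab) ac ad (edge bc) bd (edge cd) aw bw cw dw
        (λ i j i≢j → non-edge _ (indep i j i≢j))

    induced-B4 : a ~ b → Apart a c → Apart a d → b ~ c → Apart b d → c ~ d →
      (∀ i → Apart a (w i)) → (∀ i → Apart b (w i)) → (∀ i → Apart c (w i)) → (∀ i → d ~ w i) →
      InducedSub (B4 m) G
    induced-B4 ab ac ad bc bd cd aw bw cw dw =
      pendant-induced rB4 (edge ab) ac ad (edge bc) bd (edge cd) aw bw cw (edge ∘ dw)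
        (λ i j i≢j → non-edge _ (indep i j i≢j))

    induced-B3+ : a ~ b → Apart a c → Apart a d → b ~ c → b ~ d → c ~ d →
      (∀ i → Apart a (w i)) → (∀ i → Apart b (w i)) → (∀ i → c ~ w i) → (∀ i → Apart d (w i)) →
      InducedSub (B3+ m) G
    induced-B3+ ab ac ad bc bd cd aw bw cw dw =
      pendant-induced rB3+ (edge ab) ac ad (edge bc) (edge bd) (edge cd) aw bw (edge ∘ cw) dw
        (λ i j i≢j → non-edge _ (indep i j i≢j))

  -- Connected blocks

  Crossing : (V → Bool) → List V → Set
  Crossing f A = ∃₂ λ a b → a ∈ A × b ∈ A × a ~ b × f a ≡ true × f b ≡ false

  -- Connectedness by cuts: every two-colouring using both colours has a bichromatic edge.
  Connected : List V → Set
  Connected A = ∀ f {a b} → a ∈ A → b ∈ A → f a ≡ true → f b ≡ false → Crossing f A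

  -- A clique is stored with each block: `rank` measures this recorded clique, which need not be a
  -- largest one. `root` makes the block nonempty.
  record Block : Set where
    field
      verts      : List V
      connected  : Connected verts
      clique     : List V
      clique-adj : AllPairs _~_ clique
      clique⊆    : All (_∈ verts) clique
      root       : V
      root∈      : root ∈ verts
  open Block public

  rank : Block → ℕ
  rank C = length (clique C)

  Sep : Block → Block → Set
  Sep C D = ∀ u v → u ∈ verts C → v ∈ verts D → Apart u v

  Sep-sym : Symmetric Sep
  Sep-sym CD u v u∈ v∈ = Link-sym (CD v u v∈ u∈)

  sep-∈ : ∀ {Cs C D} → AllPairs Sep Cs → C ∈ Cs → D ∈ Cs → C ≡ D ⊎ Sep C D
  sep-∈ = pairs-∈ {R = Sep} (λ {C} {D} → Sep-sym {C} {D})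

  sep-partner : ∀ {Cs C} → AllPairs Sep Cs → 2 ≤ length Cs → C ∈ Cs → ∃ λ D → D ∈ Cs × Sep C D
  sep-partner = pairs-partner {R = Sep} (λ {C} {D} → Sep-sym {C} {D})

  Touches Complete : V → Block → Set
  Touches y C = Any (y ~_) (verts C)
  Complete y C = All (y ~_) (verts C)

  touches? : ∀ y → Decidable (Touches y)
  touches? y C = Any.any? (y ~?_) (verts C)

  untouched? : ∀ y → Decidable (¬_ ∘ Touches y)
  untouched? y C = ¬? (touches? y C)

  incomplete? : ∀ y → Decidable (¬_ ∘ Complete y)
  incomplete? y C = ¬? (All.all? (y ~?_) (verts C))

  Covered : List Block → V → Set
  Covered Cs y = Any (λ C → y ∈ verts C) Cs

  covered? : ∀ Cs → Decidable (Covered Cs)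
  covered? Cs y = Any.any? (λ C → Any.any? (y ≟_) (verts C)) Cs

  untouched-apart : ∀ {y u C} → y ∉ verts C → ¬ Touches y C → u ∈ verts C → Apart y u
  untouched-apart y∉ ¬t u∈ = apart (∉⇒≢ y∉ u∈) (λ yu → ¬t (lose u∈ yu))

  -- Independence comes from picking in pairwise anticomplete blocks. The result serves as the `ℓ`
  -- isolated vertices or the `m` leaves of a forbidden graph.
  transversal : ∀ {P : V → Set} r Ds → r ≤ length Ds → AllPairs Sep Ds → All (λ D → Any P (verts D)) Ds →
    Σ (Fin r → V) λ w → (∀ i → P (w i) × ∃ λ D → D ∈ Ds × w i ∈ verts D) × Independent w
  transversal zero _ _ _ _ = (λ ()) , (λ ()) , λ ()
  transversal {P} (suc r) (D ∷ Ds) (s≤s r≤) (s ∷ ss) (p ∷ ps) =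
    let w₀ , w₀∈ , p₀ = find p
        w , good , indep = transversal r Ds r≤ ss ps
        away : ∀ j → Apart w₀ (w j)
        away j = let _ , D′ , D′∈ , wj∈ = good j in All.lookup s D′∈ w₀ (w j) w₀∈ wj∈
    in w₀ Fun.∷ w ,
       (λ { zero → p₀ , D , here refl , w₀∈
          ; (suc i) → let q , D′ , D′∈ , wi∈ = good i in q , D′ , there D′∈ , wi∈ }) ,
       (λ { zero zero i≢j → contradiction refl i≢j
          ; zero (suc j) _ → away j
          ; (suc i) zero _ → Link-sym (away i)
          ; (suc i) (suc j) i≢j → indep i j (i≢j ∘ cong suc) })

  -- Whichever of `a` and `b` differs from `y` in colour lies in a block with a neighbour `c` of
  -- `y`: either the edge from `y` to `c` crosses, or that block contains a crossing edge.
  merged-connected : ∀ {y} Ds → All (Touches y) Ds → Connected (y ∷ concatMap verts Ds)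
  merged-connected {y} Ds touched f {a} {b} a∈ b∈ fa fb with f y in fy
  ... | true  = from-b b∈
    where
    from-b : b ∈ y ∷ concatMap verts Ds → Crossing f (y ∷ concatMap verts Ds)
    from-b (here refl) = contradiction (trans (sym fy) fb) λ ()
    from-b (there b∈′) with find (∈-concatMap⁻ verts b∈′)
    ... | D , D∈ , b∈D with find (All.lookup touched D∈)
    ... | c , c∈ , yc with f c in fc
    ... | false = y , c , here refl , there (∈-concatMap⁺ verts (lose D∈ c∈)) , yc , fy , fc
    ... | true  = let a′ , b′ , a′∈ , b′∈ , rest = connected D f c∈ b∈D fc fb in
                  a′ , b′ , there (∈-concatMap⁺ verts (lose D∈ a′∈)) , there (∈-concatMap⁺ verts (lose D∈ b′∈)) , rest
  ... | false = from-a a∈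
    where
    from-a : a ∈ y ∷ concatMap verts Ds → Crossing f (y ∷ concatMap verts Ds)
    from-a (here refl) = contradiction (trans (sym fa) fy) λ ()
    from-a (there a∈′) with find (∈-concatMap⁻ verts a∈′)
    ... | D , D∈ , a∈D with find (All.lookup touched D∈)
    ... | c , c∈ , yc with f c in fc
    ... | true  = c , y , there (∈-concatMap⁺ verts (lose D∈ c∈)) , here refl , ~-sym yc , fc , fy
    ... | false = let a′ , b′ , a′∈ , b′∈ , rest = connected D f a∈D c∈ fa fc in
                  a′ , b′ , there (∈-concatMap⁺ verts (lose D∈ a′∈)) , there (∈-concatMap⁺ verts (lose D∈ b′∈)) , rest

  singleton : V → Block
  singleton v = record
    { verts = v ∷ [] ; connected = λ { f (here refl) (here refl) fv ¬fv → contradiction (trans (sym fv) ¬fv) λ () }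
    ; clique = v ∷ [] ; clique-adj = [] ∷ [] ; clique⊆ = here refl ∷ [] ; root = v ; root∈ = here refl }

  rank-≤ : ∀ {k} → Colorable G k → ∀ C → rank C ≤ k
  rank-≤ (c , proper) C = injective⇒≤ λ {i} {j} ci≡cj → distinct i j (i ≟ j) ci≡cj
    where
    distinct : ∀ i j → Dec (i ≡ j) → c (lookup (clique C) i) ≡ c (lookup (clique C) j) → i ≡ j
    distinct i j (yes i≡j) _ = i≡j
    distinct i j (no i≢j) eq = contradiction eq (proper _ _ (pairs-lookup ~-sym (clique-adj C) i j i≢j))

  -- Colourings of a block

  -- Colours are assigned to all of `V` but constrained only on the block, so the decision procedure
  -- searches functions on a fixed `Fin (n G)`.
  Proper : ∀ {s} → (V → Fin s) → Block → Set
  Proper g C = All (λ u → All (λ v → u ~ v → g u ≢ g v) (verts C)) (verts C)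

  BlockColouring : Block → ℕ → Set
  BlockColouring C s = Σ (V → Fin s) λ g → Proper g C

  proper : ∀ {s} {g : V → Fin s} {C u v} → Proper g C → u ∈ verts C → v ∈ verts C → u ~ v → g u ≢ g v
  proper p u∈ v∈ = All.lookup (All.lookup p u∈) v∈

  blockColouring? : ∀ C → Decidable (BlockColouring C)
  blockColouring? C s = ∃-function? (n G)
    (λ f≗g → All.map (All.map λ ok uv eq → ok uv (trans (f≗g _) (trans eq (sym (f≗g _))))))
    (λ g → All.all? (λ u → All.all? (λ v → (u ~? v) →-dec ¬? (g u ≟ g v)) (verts C)) (verts C))

  private
    chromatic : ∀ C → ∃ λ s → BlockColouring C s × ∀ {r} → BlockColouring C r → s ≤ r
    chromatic C = least (blockColouring? C) (n G) (id , All.tabulate λ _ → All.tabulate λ _ → ~⇒≢)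

  χ : Block → ℕ
  χ C = proj₁ (chromatic C)

  -- `D` contributes only its number of colours: an optimal colouring of `C` uses `χ C ≤ χ D ≤ s`
  -- colours and is read in `Fin s`.
  χ-transfer : ∀ {C D s} → χ C ≤ χ D → BlockColouring D s → BlockColouring C s
  χ-transfer {C} {D} χ≤ colD =
    let _ , (g , ok) , _ = chromatic C
        _ , _ , min = chromatic D
        C≤s = ≤-trans χ≤ (min colD)
    in (λ u → inject≤ (g u) C≤s) ,
       All.map (All.map λ ne uv eq → ne uv (inject≤-injective C≤s C≤s _ _ eq)) ok

-- Families of pairwise anticomplete blocks

module Constants (k ℓ m : ℕ) where

  -- `t` missed blocks supply `ℓ` isolated vertices or `m` leaves, and `t` is positive. In `c`,
  -- fewer than `t` incomplete blocks are untouched and fewer than `2 + ℓ` are touched. `N` leaves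
  -- one block after discarding one for the deleted vertex and `c` for each of at most `k`
  -- representatives.
  t c N : ℕ
  t = suc (ℓ + m)
  c = t + (2 + ℓ)
  N = 2 + k * c

module Bound (G : Graph) (k ℓ m : ℕ) (critical : VertexCritical k G)
             (P4+P1s-free : Free (P4+P1s ℓ) G) (B4-free : Free (B4 m) G) (B3+-free : Free (B3+ m) G) where

  open Blocks G
  open Constants k ℓ m

  -- Otherwise connectedness gives an edge `a′b′` in `C` with `y` adjacent to `a′` only. Then `b′`,
  -- `a′`, `y`, `d` with `d` in `C′` is an induced path, and non-neighbours of `y` in `Ds` are the
  -- isolated vertices.
  no-mixed : ∀ {y C C′} Ds → ℓ ≤ length Ds → AllPairs Sep Ds → All (Sep C) Ds → All (Sep C′) Ds → Sep C C′ →
             All (λ D → Any (Apart y) (verts D)) Ds → y ∉ verts C → Touches y C → Touches y C′ → Complete y C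
  no-mixed {y} {C} {C′} Ds long seps sepC sepC′ CC′ y-misses y∉C yC yC′ with All.all? (y ~?_) (verts C)
  ... | yes complete = complete
  ... | no incomplete =
    let a , a∈ , ya = find yC
        b , b∈ , ¬yb = find (All.¬All⇒Any¬ (y ~?_) (verts C) incomplete)
        a′ , b′ , a′∈ , b′∈ , a′b′ , ya′ , ¬yb′ = connected C (adj G y) a∈ b∈ ya (Bool.¬-not ¬yb)
        d , d∈ , yd = find yC′
        w , w-good , indep = transversal ℓ Ds long seps y-misses
        away : ∀ {E u} → All (Sep E) Ds → u ∈ verts E → ∀ i → Apart u (w i)
        away sepE u∈ i = let _ , D , D∈ , wi∈ = w-good i in All.lookup sepE D∈ _ _ u∈ wi∈
        b′y : Apart b′ y
        b′y = Link-sym (∉⇒≢ y∉C b′∈ , ¬yb′)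
    in ⊥-elim (P4+P1s-free (induced-P4+P1s indep (~-sym a′b′) b′y (CC′ b′ d b′∈ d∈) (~-sym ya′) (CC′ a′ d a′∈ d∈) yd
         (away {C} sepC b′∈) (away {C} sepC a′∈) (λ i → proj₁ (w-good i)) (away {C′} sepC′ d∈)))

  -- The leaves `w` hang on `p`. If `z` and `p` are adjacent, `x z p` is the path of `B3+` and `f`
  -- completes the triangle on `zp`; otherwise `x z f p` is the path of `B4`.
  exchange : ∀ {p z f x} {w : Fin m → V} → p ≢ z → p ~ f → z ~ f → z ~ x → Apart x p → Apart x f → Independent w →
             (∀ i → p ~ w i) → (∀ i → Apart z (w i)) → (∀ i → Apart f (w i)) → (∀ i → Apart x (w i)) → ⊥
  exchange {p} {z} p≢z pf zf zx xp xf indep pw zw fw xw with z ~? p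
  ... | yes zp = B3+-free (induced-B3+ indep (~-sym zx) xp xf zp zf pf xw zw pw fw)
  ... | no ¬zp = B4-free (induced-B4 indep (~-sym zx) xf xp zf (apart (≢-sym p≢z) ¬zp) (~-sym pf) xw zw fw pw)

  -- Closed families and their weight

  record ClosedFamily : Set where
    field
      blocks : List Block
      seps   : AllPairs Sep blocks
      long   : N ≤ length blocks
      closed : ∀ y → ¬ Covered blocks y → Any (Touches y) blocks → length (filter (untouched? y) blocks) < t

  -- Merging at most N blocks into one of larger rank never decreases the total weight; since ranks
  -- are at most k, a family of weight N * N ^ k has at least N blocks.
  weight : List Block → ℕ
  weight Cs = sum (map (λ C → N ^ rank C) Cs)

  -- A single touched block passes on its clique. With several, `y` is complete to all of them and
  -- extends the clique of a block `K` of largest rank; at most `N` summands, each at most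
  -- `N ^ rank K`, total at most `N ^ suc (rank K)`.
  merge : ∀ {y} Ts → 0 < length Ts → length Ts ≤ N → All (Touches y) Ts → (2 ≤ length Ts → All (Complete y) Ts) →
          ∃ λ B → verts B ≡ y ∷ concatMap verts Ts × weight Ts ≤ N ^ rank B
  merge {y} Ts@(C ∷ []) _ _ touched _ = record
    { verts = y ∷ concatMap verts Ts ; connected = merged-connected Ts touched
    ; clique = clique C ; clique-adj = clique-adj C
    ; clique⊆ = All.map (λ u∈ → there (∈-concatMap⁺ verts {xs = Ts} (here u∈))) (clique⊆ C)
    ; root = y ; root∈ = here refl } , refl , ≤-reflexive (+-identityʳ _)
  merge {y} Ts@(C ∷ Cs@(_ ∷ _)) _ few touched complete = record
    { verts = y ∷ concatMap verts Ts ; connected = merged-connected Ts touched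
    ; clique = y ∷ clique K
    ; clique-adj = All.map (All.lookup (All.lookup (complete (s≤s (s≤s z≤n))) K∈)) (clique⊆ K) ∷ clique-adj K
    ; clique⊆ = here refl ∷ All.map (λ u∈ → there (∈-concatMap⁺ verts (lose K∈ u∈))) (clique⊆ K)
    ; root = y ; root∈ = here refl } , refl ,
    ≤-trans (sum-≤ _ Ts λ D∈ → ^-monoʳ-≤ N (All.lookup maximal D∈)) (*-monoˡ-≤ (N ^ rank K) few)
    where
    K : Block
    K = argmax rank C Cs

    K∈ : K ∈ Ts
    K∈ = [ (λ eq → here eq) , there ]′ (argmax-sel rank C Cs)

    maximal : All (λ D → rank D ≤ rank K) Ts
    maximal = f[⊥]≤f[argmax] {f = rank} C Cs ∷ f[xs]≤f[argmax] {f = rank} C Cs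

  -- Absorbing an outside vertex

  outside : List Block → ℕ
  outside Cs = length (filter (¬? ∘ covered? Cs) (allFin (n G)))

  Candidate : List Block → V → Set
  Candidate Cs y = ¬ Covered Cs y × Any (Touches y) Cs × t ≤ length (filter (untouched? y) Cs)

  candidate? : ∀ Cs → Decidable (Candidate Cs)
  candidate? Cs y = ¬? (covered? Cs y) ×-dec Any.any? (touches? y) Cs ×-dec (t ≤? length (filter (untouched? y) Cs))

  module _ (Cs : List Block) (seps : AllPairs Sep Cs) {y : V} (cand : Candidate Cs y) where

    private
      Ts = filter (touches? y) Cs
      Us = filter (untouched? y) Cs

      y∉ : ∀ {C} → C ∈ Cs → y ∉ verts C
      y∉ C∈ y∈ = proj₁ cand (lose C∈ y∈)

      TU-sep : ∀ {C D} → C ∈ Ts → D ∈ Us → Sep C D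
      TU-sep C∈ D∈ with ∈-filter⁻ (touches? y) C∈ | ∈-filter⁻ (untouched? y) D∈
      ... | C∈Cs , yC | D∈Cs , ¬yD with sep-∈ seps C∈Cs D∈Cs
      ... | inj₁ refl = contradiction yC ¬yD
      ... | inj₂ CD   = CD

    -- `no-mixed` applies with another touched block as `C′`; the untouched ones, at least `t > ℓ`
    -- in number, supply the isolated vertices.
    touched-complete : 2 ≤ length Ts → All (Complete y) Ts
    touched-complete 2≤ = All.tabulate λ {C} C∈ →
      let C′ , C′∈ , CC′ = sep-partner (AllPairs.filter⁺ (touches? y) seps) 2≤ C∈
          C∈Cs , yC = ∈-filter⁻ (touches? y) C∈
      in no-mixed {C = C} {C′} Us (≤-trans (m≤n⇒m≤1+n (m≤m+n ℓ m)) (proj₂ (proj₂ cand)))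
           (AllPairs.filter⁺ (untouched? y) seps) (All.tabulate (TU-sep C∈)) (All.tabulate (TU-sep C′∈)) CC′
           (All.tabulate λ {D} D∈ → let D∈Cs , ¬yD = ∈-filter⁻ (untouched? y) D∈ in
             lose (root∈ D) (untouched-apart {C = D} (y∉ D∈Cs) ¬yD (root∈ D)))
           (y∉ C∈Cs) yC (proj₂ (∈-filter⁻ (touches? y) {xs = Cs} C′∈))

    touched-nonempty : 0 < length Ts
    touched-nonempty = let C , C∈ , yC = find (proj₁ (proj₂ cand)) in ∈-length (∈-filter⁺ (touches? y) C∈ yC)

    enlarge : length Ts ≤ N → ∃ λ Cs′ → AllPairs Sep Cs′ × weight Cs ≤ weight Cs′ × outside Cs′ < outside Cs
    enlarge few with merge Ts touched-nonempty few (All.all-filter (touches? y) Cs) touched-complete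
    ... | B , B≡ , heavy = B ∷ Us ,
          All.tabulate B-sep ∷ AllPairs.filter⁺ (untouched? y) seps ,
          ≤-trans (≤-reflexive (sym (sum-split (touches? y) _ Cs))) (+-monoˡ-≤ (weight Us) heavy) ,
          -- `y` becomes covered and no covered vertex is lost, so `outside` drops and `close`
          -- terminates.
          count-mono-< (¬? ∘ covered? (B ∷ Us)) (¬? ∘ covered? Cs) (allFin (n G)) (λ _ ¬cov cov → ¬cov (still-covered cov))
            (∈-allFin y) (proj₁ cand) (λ ¬cov → ¬cov (here (subst (y ∈_) (sym B≡) (here refl))))
      where
      B-sep : ∀ {D} → D ∈ Us → Sep B D
      B-sep {D} D∈ u v u∈ v∈ with subst (u ∈_) B≡ u∈
      ... | here refl = let D∈Cs , ¬yD = ∈-filter⁻ (untouched? y) D∈ in untouched-apart {C = D} (y∉ D∈Cs) ¬yD v∈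
      ... | there u∈T = let C , C∈ , u∈C = find (∈-concatMap⁻ verts u∈T) in TU-sep C∈ D∈ u v u∈C v∈

      still-covered : ∀ {u} → Covered Cs u → Covered (B ∷ Us) u
      still-covered cov with find cov
      ... | C , C∈ , u∈ with touches? y C
      ... | yes yC = here (subst (_ ∈_) (sym B≡) (there (∈-concatMap⁺ verts (lose (∈-filter⁺ (touches? y) C∈ yC) u∈))))
      ... | no ¬yC = there (lose (∈-filter⁺ (untouched? y) C∈ ¬yC) u∈)

    -- Suppose `z` misses `t` blocks of `Ts`. If `z` touches a block of `Us`, `exchange` gives a
    -- forbidden graph. If not, `z` is itself a candidate that touches only blocks of `Ts`, and not
    -- all of them, against `minimal`.
    touched-closed : (∀ {z} → Candidate Cs z → length Ts ≤ length (filter (touches? z) Cs)) → All (Complete y) Ts →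
      ∀ z → ¬ Covered Ts z → Any (Touches z) Ts → length (filter (untouched? z) Ts) < t
    touched-closed minimal complete z z∉T zT = ≰⇒> impossible
      where
      Qs = filter (untouched? z) Ts

      f-block = proj₁ (find zT)
      f-block∈ : f-block ∈ Ts
      f-block∈ = proj₁ (proj₂ (find zT))
      z-f-block : Touches z f-block
      z-f-block = proj₂ (proj₂ (find zT))
      f = proj₁ (find z-f-block)
      f∈ : f ∈ verts f-block
      f∈ = proj₁ (proj₂ (find z-f-block))
      zf : z ~ f
      zf = proj₂ (proj₂ (find z-f-block))

      Q-sep : ∀ {D} → D ∈ Qs → D ∈ Cs × D ∈ Ts × ¬ Touches z D × Sep f-block D
      Q-sep D∈ with ∈-filter⁻ (untouched? z) D∈
      ... | D∈T , ¬zD with sep-∈ (AllPairs.filter⁺ (touches? y) seps) f-block∈ D∈T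
      ... | inj₁ refl = contradiction z-f-block ¬zD
      ... | inj₂ sep  = proj₁ (∈-filter⁻ (touches? y) D∈T) , D∈T , ¬zD , sep

      -- `y` touches every block of `Ts`, whereas `z` misses one because `t` is positive.
      y≢z : t ≤ length Qs → y ≢ z
      y≢z t≤ refl with Qs in eq
      y≢z () refl | []
      ... | D ∷ _ = let _ , D∈T , ¬zD , _ = Q-sep (subst (D ∈_) (sym eq) (here refl)) in
                    ¬zD (proj₂ (∈-filter⁻ (touches? y) {xs = Cs} D∈T))

      z-uncovered : ¬ Covered Cs z
      z-uncovered cov with find cov
      ... | D , D∈ , z∈D with touches? y D
      ... | yes yD = z∉T (lose (∈-filter⁺ (touches? y) D∈ yD) z∈D)
      -- A block of `Us` cannot contain `z`, whose neighbour `f` lies in a block of `Ts`.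
      ... | no ¬yD = apart⇒¬~ (TU-sep f-block∈ (∈-filter⁺ (untouched? y) D∈ ¬yD) f z f∈ z∈D) (~-sym zf)

      impossible : ¬ t ≤ length Qs
      impossible t≤ with Any.any? (touches? z) Us
      ... | yes zU =
        let D , D∈ , zD = find zU
            x , x∈ , zx = find zD
            D∈Cs , ¬yD = ∈-filter⁻ (untouched? y) D∈
            w , w-good , indep = transversal {P = Apart z} m Qs (≤-trans (m≤n⇒m≤1+n (m≤n+m m ℓ)) t≤)
              (AllPairs.filter⁺ (untouched? z) (AllPairs.filter⁺ (touches? y) seps))
              (All.tabulate λ {E} E∈ → let E∈Cs , _ , ¬zE , _ = Q-sep E∈ in
                lose (root∈ E) (untouched-apart {C = E} (λ z∈ → z-uncovered (lose E∈Cs z∈)) ¬zE (root∈ E)))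
        in exchange (y≢z t≤) (All.lookup (All.lookup complete f-block∈) f∈) zf zx
             (Link-sym (untouched-apart {C = D} (y∉ D∈Cs) ¬yD x∈))
             (Link-sym (TU-sep f-block∈ D∈ f x f∈ x∈))
             indep
             (λ i → let _ , E , E∈ , wi∈ = w-good i ; _ , E∈T , _ = Q-sep E∈ in All.lookup (All.lookup complete E∈T) wi∈)
             (λ i → proj₁ (w-good i))
             (λ i → let _ , E , E∈ , wi∈ = w-good i ; _ , _ , _ , sep = Q-sep E∈ in sep f (w i) f∈ wi∈)
             (λ i → let _ , E , E∈ , wi∈ = w-good i ; _ , E∈T , _ = Q-sep E∈ in Link-sym (TU-sep E∈T D∈ (w i) x wi∈ x∈))
      ... | no ¬zU = <-irrefl refl (<-≤-trans fewer (minimal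
              (z-uncovered , lose (proj₁ (∈-filter⁻ (touches? y) {xs = Cs} f-block∈)) z-f-block ,
               ≤-trans t≤ (count-filter-≤ (untouched? z) (touches? y) Cs))))
        where
        touched-by-y : ∀ {D} → D ∈ Cs → Touches z D → Touches y D
        touched-by-y {D} D∈ zD with touches? y D
        ... | yes yD = yD
        ... | no ¬yD = contradiction (lose (∈-filter⁺ (untouched? y) D∈ ¬yD) zD) ¬zU

        fewer : length (filter (touches? z) Cs) < length Ts
        fewer = begin-strict
          length (filter (touches? z) Cs)             ≤⟨ count-filter-≥ (touches? z) (touches? y) Cs touched-by-y ⟩
          length (filter (touches? z) Ts)             <⟨ m<m+n _ (≤-trans (s≤s z≤n) t≤) ⟩
          length (filter (touches? z) Ts) + length Qs ≡⟨ length-split (touches? z) Ts ⟩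
          length Ts                                   ∎
          where open ≤-Reasoning

  weight-≤ : ∀ Cs → weight Cs ≤ length Cs * N ^ k
  weight-≤ Cs = sum-≤ _ Cs λ {C} _ → ^-monoʳ-≤ N (rank-≤ (proj₁ (proj₁ critical)) C)

  close : ∀ Cs → Acc _<_ (outside Cs) → AllPairs Sep Cs → N * N ^ k ≤ weight Cs → ClosedFamily
  close Cs (acc rec) seps heavy with minimiser (candidate? Cs) (λ y → length (filter (touches? y) Cs))
  ... | inj₁ none = record { blocks = Cs ; seps = seps
          ; long = *-cancelʳ-≤ N (length Cs) (N ^ k) {{m^n≢0 N k}} (≤-trans heavy (weight-≤ Cs))
          ; closed = λ y y∉ touches → ≰⇒> λ t≤ → none y (y∉ , touches , t≤) }
  ... | inj₂ (y , cand , minimal) with length (filter (touches? y) Cs) ≤? N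
  ...   | yes few = let Cs′ , seps′ , heavier , smaller = enlarge Cs seps cand few in
                    close Cs′ (rec smaller) seps′ (≤-trans heavy heavier)
  ...   | no many = record { blocks = filter (touches? y) Cs ; seps = AllPairs.filter⁺ (touches? y) seps
          ; long = <⇒≤ (≰⇒> many)
          ; closed = touched-closed Cs seps cand minimal
              (touched-complete Cs seps cand (≤-trans (s≤s (s≤s z≤n)) (<⇒≤ (≰⇒> many)))) }

  -- `closed` bounds the untouched blocks. Of `2 + ℓ` touched but incomplete blocks, two would act
  -- as `C` and `C′` in `no-mixed`, the others each containing a non-neighbour of `y`.
  few-incomplete : ∀ (F : ClosedFamily) → let open ClosedFamily F in ∀ {y} → ¬ Covered blocks y → Any (Touches y) blocks →
                   length (filter (incomplete? y) blocks) ≤ c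
  few-incomplete F {y} y∉ touches = ≮⇒≥ λ c< → all-touched Ts (enough c<)
      (AllPairs.filter⁺ (touches? y) (AllPairs.filter⁺ (incomplete? y) seps))
      (All.tabulate λ C∈ → let C∈I , yC = ∈-filter⁻ (touches? y) C∈
                               C∈Cs , ¬complete = ∈-filter⁻ (incomplete? y) C∈I in C∈Cs , yC , ¬complete)
    where
    open ClosedFamily F
    Is = filter (incomplete? y) blocks
    Ts = filter (touches? y) Is

    enough : c < length Is → 2 + ℓ ≤ length Ts
    enough c< = +-cancelˡ-≤ t _ _ (begin
      t + (2 + ℓ)                                  ≤⟨ <⇒≤ c< ⟩
      length Is                                    ≡⟨ length-split (touches? y) Is ⟨
      length Ts + length (filter (untouched? y) Is) ≤⟨ +-monoʳ-≤ (length Ts) (≤-trans (count-filter-≤ (untouched? y) (incomplete? y) blocks) (<⇒≤ (closed y y∉ touches))) ⟩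
      length Ts + t                                ≡⟨ +-comm (length Ts) t ⟩
      t + length Ts                                ∎)
      where open ≤-Reasoning

    all-touched : ∀ Ds → 2 + ℓ ≤ length Ds → AllPairs Sep Ds →
                  ¬ All (λ D → D ∈ blocks × Touches y D × ¬ Complete y D) Ds
    all-touched (C ∷ C′ ∷ Ds) (s≤s (s≤s ℓ≤)) ((CC′ ∷ CD) ∷ C′D ∷ DD) ((C∈ , yC , ¬complete) ∷ (_ , yC′ , _) ∷ rest) =
      ¬complete (no-mixed {C = C} {C′} Ds ℓ≤ DD CD C′D CC′
        (All.map (λ {D} (D∈ , _ , ¬complete) →
          let b , b∈ , ¬yb = find (All.¬All⇒Any¬ (y ~?_) (verts D) ¬complete) in
          lose b∈ (apart (∉⇒≢ (λ y∈ → y∉ (lose D∈ y∈)) b∈) ¬yb)) rest)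
        (λ y∈ → y∉ (lose C∈ y∈)) yC yC′)

  -- Recolouring a lightest block

  lightest : ∀ Cs → 0 < length Cs → ∃ λ C → C ∈ Cs × All (λ D → χ C ≤ χ D) Cs
  lightest (C ∷ Cs) _ = argmin χ C Cs , [ (λ eq → here eq) , there ]′ (argmin-sel χ C Cs) ,
    f[argmin]≤f[⊤] {f = χ} C Cs ∷ f[argmin]≤f[xs] {f = χ} C Cs

  module _ (F : ClosedFamily) {C₁ : Block} (C₁∈ : C₁ ∈ ClosedFamily.blocks F)
           {j : ℕ} (φ : V → Fin j) (φ-proper : ∀ {u w} → root C₁ ≢ u → root C₁ ≢ w → u ~ w → φ u ≢ φ w) where

    open ClosedFamily F
    private
      v = root C₁

    Attached : V → Set
    Attached u = ¬ Covered blocks u × Touches u C₁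

    AvoidsAttached : Block → Set
    AvoidsAttached C = ∀ {w x} → Attached w → x ∈ verts C → φ x ≢ φ w

    -- The blocks are pairwise anticomplete, so no conflict across the border of `C₁` involves
    -- another block: only `Attached` vertices matter.
    attached : ∀ {u w} → u ∈ verts C₁ → w ∉ verts C₁ → u ~ w → Attached w
    attached {u} {w} u∈ w∉ uw = uncovered , lose u∈ (~-sym uw)
      where
      uncovered : ¬ Covered blocks w
      uncovered cov with find cov
      ... | D , D∈ , w∈D with sep-∈ seps C₁∈ D∈
      ... | inj₁ refl = w∉ w∈D
      ... | inj₂ sep  = apart⇒¬~ (sep u w u∈ w∈D) uw

    private
      containing? : Decidable (λ C → v ∈ verts C)
      containing? C = v ∈? verts C

      avoiding : List Block
      avoiding = filter (¬? ∘ containing?) blocks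

      v∉ : ∀ {C} → C ∈ avoiding → v ∉ verts C
      v∉ C∈ = proj₂ (∈-filter⁻ (¬? ∘ containing?) {xs = blocks} C∈)

      at-most-one : ∀ Ds → AllPairs Sep Ds → All (λ D → v ∈ verts D) Ds → length Ds ≤ 1
      at-most-one [] _ _ = z≤n
      at-most-one (_ ∷ []) _ _ = s≤s z≤n
      at-most-one (_ ∷ _ ∷ _) ((CD ∷ _) ∷ _) (v∈C ∷ v∈D ∷ _) = contradiction refl (proj₁ (CD v v v∈C v∈D))

      enough : j ≤ k → ∀ {r} → r ≤ length (allFin j) → r * c < length avoiding
      enough j≤k {r} r≤ = +-cancelˡ-≤ 1 _ _ (begin
        2 + r * c            ≤⟨ +-monoʳ-≤ 2 (*-monoˡ-≤ c (≤-trans r≤ (≤-trans (≤-reflexive (length-allFin j)) j≤k))) ⟩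
        N                    ≤⟨ long ⟩
        length blocks        ≡⟨ length-split containing? blocks ⟨
        length (filter containing? blocks) + length avoiding
                             ≤⟨ +-monoˡ-≤ _ (at-most-one _ (AllPairs.filter⁺ containing? seps) (All.all-filter containing? blocks)) ⟩
        1 + length avoiding  ∎)
        where open ≤-Reasoning

    -- A block avoiding `v` and complete to one representative of each colour on attached vertices
    -- contains none of these colours. Blocks through `v` are set aside because `φ` is unconstrained
    -- there.
    donor : j ≤ k → ∃ λ C → C ∈ blocks × v ∉ verts C × AvoidsAttached C
    donor j≤k
      with rs , few , rs-attached , rep ← representatives {P = Attached} φ (allFin j) (λ i →
             any? λ u → (¬? (covered? blocks u) ×-dec touches? u C₁) ×-dec (φ u ≟ i))
      with C , C∈ , complete ← avoid incomplete? rs avoiding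
             (λ {r} r∈ → let r∉ , r~C₁ = All.lookup rs-attached r∈ in
               ≤-trans (count-filter-≤ (incomplete? r) (¬? ∘ containing?) blocks) (few-incomplete F r∉ (lose C₁∈ r~C₁)))
             (enough j≤k few)
      = C , proj₁ (∈-filter⁻ (¬? ∘ containing?) C∈) , v∉ C∈ , λ att x∈ φx≡φw →
          let r , r∈ , φr≡φw = find (rep att (∈-allFin _))
              r~C = decidable-stable (All.all? (r ~?_) (verts C)) (All.lookup complete r∈)
          in φ-proper (λ { refl → proj₁ (All.lookup rs-attached r∈) (lose C₁∈ (root∈ C₁)) }) (∉⇒≢ (v∉ C∈) x∈)
               (All.lookup r~C x∈) (trans φr≡φw (sym φx≡φw))

    module _ {C : Block} (v∉C : v ∉ verts C) (avoids : AvoidsAttached C) (lighter : χ C₁ ≤ χ C) where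

      private
        palette : List (Fin j)
        palette = deduplicate _≟_ (map φ (verts C))

        φ∈palette : ∀ {u} → u ∈ verts C → φ u ∈ palette
        φ∈palette u∈ = ∈-deduplicate⁺ _≟_ (∈-map⁺ φ u∈)

        position : V → Fin (length palette)
        position u with φ u ∈? palette
        ... | yes φu∈ = Any.index φu∈
        -- Placeholder for colours missing from the palette; it only makes `position` total.
        ... | no _    = Any.index (φ∈palette (root∈ C))

        φ≡position : ∀ {u} → u ∈ verts C → φ u ≡ lookup palette (position u)
        φ≡position {u} u∈ with φ u ∈? palette
        ... | yes φu∈ = lookup-index φu∈
        ... | no φu∉  = contradiction (φ∈palette u∈) φu∉

        C-colouring : BlockColouring C (length palette)
        C-colouring = position , All.tabulate λ u∈ → All.tabulate λ w∈ uw eq →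
          φ-proper (∉⇒≢ v∉C u∈) (∉⇒≢ v∉C w∈) uw
            (trans (φ≡position u∈) (trans (cong (lookup palette) eq) (sym (φ≡position w∈))))

        palette-injective : ∀ {a b} → lookup palette a ≡ lookup palette b → a ≡ b
        palette-injective {a} {b} eq with a ≟ b
        ... | yes a≡b = a≡b
        ... | no a≢b  = contradiction eq (pairs-lookup ≢-sym (deduplicate-! _≟_ (map φ (verts C))) a b a≢b)

        palette-unused : ∀ {w} → Attached w → ∀ a → lookup palette a ≢ φ w
        palette-unused att a eq =
          let x , x∈ , a≡φx = ∈-map⁻ φ (∈-deduplicate⁻ _≟_ (map φ (verts C)) (∈-lookup a))
          in avoids att x∈ (trans (sym a≡φx) eq)

      -- `C₁` needs no more colours than `C` shows under `φ`, so it can take over those, and they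
      -- clash with no attached vertex. This also replaces the colour of `v`, the one vertex where
      -- `φ` was unconstrained.
      recolouring : Colorable G j
      recolouring with g , g-proper ← χ-transfer {C₁} {C} lighter C-colouring =
        ψ , λ u w uw → ψ-proper uw (u ∈? verts C₁) (w ∈? verts C₁)
        where
        recolour : ∀ u → Dec (u ∈ verts C₁) → Fin j
        recolour u (yes _) = lookup palette (g u)
        recolour u (no _)  = φ u

        ψ : V → Fin j
        ψ u = recolour u (u ∈? verts C₁)

        ψ-proper : ∀ {u w} → u ~ w → (d : Dec (u ∈ verts C₁)) (d′ : Dec (w ∈ verts C₁)) →
                   recolour u d ≢ recolour w d′
        ψ-proper uw (yes u∈) (yes w∈) eq = proper {C = C₁} g-proper u∈ w∈ uw (palette-injective eq)
        ψ-proper uw (yes u∈) (no w∉)  eq = palette-unused (attached u∈ w∉ uw) _ eq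
        ψ-proper uw (no u∉)  (yes w∈) eq = palette-unused (attached w∈ u∉ (~-sym uw)) _ (sym eq)
        ψ-proper uw (no u∉)  (no w∉)  eq = φ-proper (≢-sym (∉⇒≢ u∉ (root∈ C₁))) (≢-sym (∉⇒≢ w∉ (root∈ C₁))) uw eq

  no-closed-family : ¬ ClosedFamily
  no-closed-family F
    with C₁ , C₁∈ , min ← lightest (ClosedFamily.blocks F) (≤-trans (s≤s z≤n) (ClosedFamily.long F))
    -- `C₂` supplies the vertex other than `root C₁` that `punctured-colouring` asks for.
    with C₂ , C₂∈ , sep ← sep-partner (ClosedFamily.seps F) (≤-trans (s≤s (s≤s z≤n)) (ClosedFamily.long F)) C₁∈
    with j , j<k , φ , φ-proper ← punctured-colouring G (root C₁) (proj₂ critical (root C₁))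
                                    (proj₁ (sep (root C₁) (root C₂) (root∈ C₁) (root∈ C₂)))
    with C , C∈ , v∉C , avoids ← donor F C₁∈ φ φ-proper (<⇒≤ j<k)
    = <⇒≱ j<k (proj₂ (proj₁ critical) j (recolouring F C₁∈ φ φ-proper {C} v∉C avoids (All.lookup min C∈)))

  -- Bound on the order

  weight-singletons : ∀ vs → weight (map singleton vs) ≡ length vs * N ^ 1
  weight-singletons []       = refl
  weight-singletons (_ ∷ vs) = cong (N ^ 1 +_) (weight-singletons vs)

  -- Otherwise some colour class has more than `N ^ k` vertices. As singleton blocks of rank 1 they
  -- weigh `N` each, which gives the total `N * N ^ k` that `close` requires.
  order-≤ : n G ≤ k * N ^ k
  order-≤ = ≮⇒≥ λ large →
    let colour , proper = proj₁ (proj₁ critical)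
        i , many = crowded-class colour (N ^ k) (allFin (n G)) (subst (k * N ^ k <_) (sym (length-allFin (n G))) large)
        in-class? = λ u → colour u ≟ i
        class = filter in-class? (allFin (n G))
        seps = AllPairs.map
          (λ { (u≢w , cu , cw) _ _ (here refl) (here refl) → apart u≢w λ uw → proper _ _ uw (trans cu (sym cw)) })
          (pairs-with-all (AllPairs.filter⁺ in-class? (allFin⁺ (n G))) (All.all-filter in-class? (allFin (n G))))
        heavy = begin
          N * N ^ k                     ≡⟨ *-comm N (N ^ k) ⟩
          N ^ k * N                     ≤⟨ *-monoˡ-≤ N (<⇒≤ many) ⟩
          length class * N              ≡⟨ cong (length class *_) (*-identityʳ N) ⟨
          length class * N ^ 1          ≡⟨ weight-singletons class ⟨
          weight (map singleton class)  ∎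
    in no-closed-family (close (map singleton class) (<-wellFounded _) (AllPairs.map⁺ seps) heavy)
    where open ≤-Reasoning

theorem1 : ∀ (k ℓ m : ℕ) → k ≥ 1 →
    Σ (List Graph) λ L → ∀ (G : Graph) → VertexCritical k G →
    Free (P4+P1s ℓ) G → Free (B4 m) G → Free (B3+ m) G →
    Any (λ H → G ≅ H) L
theorem1 k ℓ m _ = graphsUpTo (k * Constants.N k ℓ m ^ k) , λ G critical P4+P1s-free B4-free B3+-free →
  graphsUpTo-complete G (Bound.order-≤ G k ℓ m critical P4+P1s-free B4-free B3+-free)
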